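{- There is a constant $C>0$ such that for all sufficiently large integers $k$, every deterministic online algorithm for the problem restricted to instances in which all jobs have unit weight ($w_j=1$) and processing time at most $k$ has competitive ratio at least $C\log k/\log\log k$. That is, the deterministic competitive ratio is $\Omega(\log k/\log\log k)$.
   Context: Model: online preemptive scheduling on a single machine (preemption with resume) in discrete time. Each job $j$ has an integer release time $r_j$, integer processing time $p_j\ge1$, integer deadline $d_j$ and weight $w_j$; job $j$ becomes known to the algorithm only at time $r_j$. At each integer time $t$ the machine processes at most one unit of one job, occupying $[t,t+1)$; a job is completed on time if it receives $p_j$ units of processing at integer times $t$ with $r_j\le t<d_j$. $\mathrm{ALG}(I)$ is the total weight of jobs the algorithm completes on time on instance $I$; $\mathrm{OPT}(I)$ is the maximum total weight achievable by an offline schedule. The competitive ratio of an algorithm is the infimum of $R$ such that $\mathrm{OPT}(I)\le R\cdot\mathrm{ALG}(I)$ for all instances $I$. -}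

module Defs where

open import Data.Nat using (ℕ; zero; suc; _≤_; _<_; _≤?_; _≟_)
open import Data.Nat.Logarithm using (⌊log₂_⌋)
open import Data.Maybe using (Maybe; just; nothing)
import Data.Maybe as Maybe
open import Data.List using (List; []; _∷_; filter; length)
open import Data.Integer using (+_)
open import Data.Rational using (ℚ; _/_)
open import Relation.Nullary using (yes; no)
open import Relation.Binary.PropositionalEquality using (_≡_)

-- A job: integer release time r, processing time p ≥ 1 (imposed in the
-- instance class), deadline d, and weight w.  Time is discrete, t ∈ ℕ.
record Job : Set where
  constructor job
  field
    release    : ℕ
    processing : ℕ
    deadline   : ℕ
    weight     : ℕ
open Job public

-- An instance is a finite list of jobs; job identities are list positions.
Instance : Set
Instance = List Job

-- A schedule: at integer time t, process one unit of (the job with index)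
-- i, or idle (nothing).
Schedule : Set
Schedule = ℕ → Maybe ℕ

unitsBefore : Schedule → ℕ → Job → ℕ → ℕ
unitsBefore σ i j zero = zero
unitsBefore σ i j (suc s) with σ s | release j ≤? s
... | just i' | yes _ with i' ≟ i
...   | yes _ = suc (unitsBefore σ i j s)
...   | no  _ = unitsBefore σ i j s
unitsBefore σ i j (suc s) | just _ | no _ = unitsBefore σ i j s
unitsBefore σ i j (suc s) | nothing | _ = unitsBefore σ i j s

units : Schedule → ℕ → Job → ℕ
units σ i j = unitsBefore σ i j (deadline j)

valueFrom : Schedule → ℕ → Instance → ℕ
valueFrom σ i [] = 0
valueFrom σ i (j ∷ js) with processing j ≤? units σ i j
... | yes _ = weight j Data.Nat.+ valueFrom σ (suc i) js
... | no  _ = valueFrom σ (suc i) js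

value : Schedule → Instance → ℕ
value σ I = valueFrom σ 0 I

known : ℕ → Instance → List Job
known t I = filter (λ j → release j ≤? t) I

-- A deterministic online algorithm: at time t, given only t and the jobs
-- released so far (it can recompute its own past decisions), it picks an
-- index into the list of known jobs, or idles.
OnlineAlgorithm : Set
OnlineAlgorithm = ℕ → List Job → Maybe ℕ

toOrig : ℕ → Instance → ℕ → Maybe ℕ
toOrig t [] k = nothing
toOrig t (j ∷ js) k with release j ≤? t
toOrig t (j ∷ js) zero    | yes _ = just zero
toOrig t (j ∷ js) (suc k) | yes _ = Maybe.map suc (toOrig t js k)
toOrig t (j ∷ js) k       | no  _ = Maybe.map suc (toOrig t js k)

run : OnlineAlgorithm → Instance → Schedule
run A I t with A t (known t I)
... | nothing = nothing
... | just k  = toOrig t I k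

data AllJobs (P : Job → Set) : Instance → Set where
  []  : AllJobs P []
  _∷_ : ∀ {j js} → P j → AllJobs P js → AllJobs P (j ∷ js)

UnitJobMaxK : ℕ → Job → Set
UnitJobMaxK k j = (weight j ≡ 1) Data.Product.× (1 ≤ processing j) Data.Product.× (processing j ≤ k)
  where import Data.Product

ValidInstance : ℕ → Instance → Set
ValidInstance k I = AllJobs (UnitJobMaxK k) I

toℚ : ℕ → ℚ
toℚ n = (+ n) / 1

-- R (rational) is an admissible competitive ratio for A on the class of
-- instances with unit weights and processing times ≤ k:
-- OPT(I) ≤ R · ALG(I) for all I, where OPT(I) ≤ R·ALG(I) is expressed as
-- "every offline schedule σ has value ≤ R·ALG(I)".
Competitive : ℕ → OnlineAlgorithm → ℚ → Set
Competitive k A R =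
  ∀ (I : Instance) → ValidInstance k I →
  ∀ (σ : Schedule) → toℚ (value σ I) Data.Rational.≤ R Data.Rational.* toℚ (value (run A I) I)

{-# OPTIONS --safe #-}
module Submission where

-- The adversary keeps A with a single completable job while an offline schedule
-- accumulates N of them.  If A's only hope is a "main" job of slack s, tight "bait"
-- jobs longer than s are released back to back.  Either A sticks to the main job and
-- the offline schedule serves N baits, or A spends more than s steps on a bait and
-- dooms its main job.  During that bait, much smaller main jobs, whose windows have
-- length s, are released: again A either ignores N of them, or touches one and dooms
-- the tight bait.  In the latter case the offline schedule ignores the baits, works
-- on the large main job, and uses its slack s to recurse inside the window of the
-- small one.  Each level costs a factor of at most (N + 2)² in length, so that N
-- levels fit as soon as (N + 2)^(2N) ≤ k.

open import Defs
open import Data.Nat using (ℕ)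
open import Data.Nat.Logarithm using (⌊log₂_⌋)
open import Data.Product using (Σ; _×_)
open import Data.Rational using (ℚ; Positive; _≤_; _*_)

import Data.Integer as ℤ
import Data.Integer.Properties as ℤ
open import Data.List using ([]; _∷_; _++_; _∷ʳ_; length)
open import Data.List.Properties using (++-assoc; ++-identityʳ; ∷ʳ-++; length-++; filter-++; filter-reject)
open import Data.Maybe using (Maybe; just; nothing)
import Data.Maybe as Maybe
open import Data.Maybe.Properties using (just-injective)
open import Data.Nat using (zero; suc; z≤n; s≤s; _≤?_; _<?_; _≟_; _∸_; NonZero)
import Data.Nat as ℕ
import Data.Nat.Coprimality as Coprimality
open import Data.Nat.DivMod using (m/n*n≤m; m≡m%n+[m/n]*n; m%n<n; m≥n⇒m/n>0)
open import Data.Nat.Logarithm using (⌊log₂⌋-mono-≤; ⌊log₂[2^n]⌋≡n; ⌊log₂⌊n/2⌋⌋≡⌊log₂n⌋∸1)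
import Data.Nat.Properties as ℕ
open import Data.Nat.Tactic.RingSolver using (solve-∀)
open import Data.Product using (∃; _,_)
open import Data.Rational using (mkℚ; *≤*)
import Data.Rational as ℚ
import Data.Rational.Properties as ℚ
open import Data.Sum using (_⊎_; inj₁; inj₂)
open import Function using (_∘_)
open import Relation.Binary.PropositionalEquality using (_≡_; _≢_; refl; sym; trans; cong; subst)
open import Relation.Nullary using (yes; no; contradiction)

private
  variable
    σ τ : Schedule
    i t t′ : ℕ
    j j′ : Job
    I J : Instance

-- Units of processing

unitsBefore-hit : ∀ σ i j t → σ t ≡ just i → release j ℕ.≤ t →
  unitsBefore σ i j (suc t) ≡ suc (unitsBefore σ i j t)
unitsBefore-hit σ i j t eq r≤t with σ t | release j ≤? t
... | just i′ | yes _ with i′ ≟ i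
...   | yes _    = refl
...   | no i′≢i  = contradiction (just-injective eq) i′≢i
unitsBefore-hit σ i j t eq r≤t | just _ | no r≰t = contradiction r≤t r≰t

unitsBefore-step : ∀ σ i j t →
  (unitsBefore σ i j (suc t) ≡ unitsBefore σ i j t) ⊎
  (σ t ≡ just i × release j ℕ.≤ t × unitsBefore σ i j (suc t) ≡ suc (unitsBefore σ i j t))
unitsBefore-step σ i j t with σ t | release j ≤? t
... | just i′ | yes r≤t with i′ ≟ i
...   | yes refl = inj₂ (refl , r≤t , refl)
...   | no _     = inj₁ refl
unitsBefore-step σ i j t | just _  | no _ = inj₁ refl
unitsBefore-step σ i j t | nothing | _    = inj₁ refl

unitsBefore-≤-step : ∀ σ i j t → unitsBefore σ i j t ℕ.≤ unitsBefore σ i j (suc t)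
unitsBefore-≤-step σ i j t with unitsBefore-step σ i j t
... | inj₁ eq           = ℕ.≤-reflexive (sym eq)
... | inj₂ (_ , _ , eq) = ℕ.≤-trans (ℕ.n≤1+n _) (ℕ.≤-reflexive (sym eq))

unitsBefore-mono-+ : ∀ σ i j t m → unitsBefore σ i j t ℕ.≤ unitsBefore σ i j (m ℕ.+ t)
unitsBefore-mono-+ σ i j t zero    = ℕ.≤-refl
unitsBefore-mono-+ σ i j t (suc m) =
  ℕ.≤-trans (unitsBefore-mono-+ σ i j t m) (unitsBefore-≤-step σ i j (m ℕ.+ t))

unitsBefore-+-≤ : ∀ σ i j t m → unitsBefore σ i j (m ℕ.+ t) ℕ.≤ m ℕ.+ unitsBefore σ i j t
unitsBefore-+-≤ σ i j t zero = ℕ.≤-refl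
unitsBefore-+-≤ σ i j t (suc m) with unitsBefore-step σ i j (m ℕ.+ t)
... | inj₁ eq           = ℕ.≤-trans (ℕ.≤-reflexive eq) (ℕ.m≤n⇒m≤1+n (unitsBefore-+-≤ σ i j t m))
... | inj₂ (_ , _ , eq) = ℕ.≤-trans (ℕ.≤-reflexive eq) (s≤s (unitsBefore-+-≤ σ i j t m))

unitsBefore-busy : ∀ σ i j t m → release j ℕ.≤ t →
  (∀ s → t ℕ.≤ s → s ℕ.< m ℕ.+ t → σ s ≡ just i) →
  m ℕ.+ unitsBefore σ i j t ℕ.≤ unitsBefore σ i j (m ℕ.+ t)
unitsBefore-busy σ i j t zero    r≤t busy = ℕ.≤-refl
unitsBefore-busy σ i j t (suc m) r≤t busy = ℕ.≤-trans
  (s≤s (unitsBefore-busy σ i j t m r≤t λ s t≤s s< → busy s t≤s (ℕ.m≤n⇒m≤1+n s<)))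
  (ℕ.≤-reflexive (sym (unitsBefore-hit σ i j (m ℕ.+ t)
    (busy (m ℕ.+ t) (ℕ.m≤n+m t m) ℕ.≤-refl) (ℕ.≤-trans r≤t (ℕ.m≤n+m t m)))))

unitsBefore-mono-schedule : ∀ i j t →
  (∀ s → s ℕ.< t → σ s ≡ just i → τ s ≡ just i) →
  unitsBefore σ i j t ℕ.≤ unitsBefore τ i j t
unitsBefore-mono-schedule i j zero σ⊆τ = z≤n
unitsBefore-mono-schedule {σ} {τ} i j (suc t) σ⊆τ
  with unitsBefore-step σ i j t | unitsBefore-mono-schedule i j t (λ s s<t → σ⊆τ s (ℕ.m≤n⇒m≤1+n s<t))
... | inj₁ eq             | ih = ℕ.≤-trans (ℕ.≤-reflexive eq) (ℕ.≤-trans ih (unitsBefore-≤-step τ i j t))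
... | inj₂ (hit , r≤t , eq) | ih = ℕ.≤-trans (ℕ.≤-reflexive eq) (ℕ.≤-trans (s≤s ih)
  (ℕ.≤-reflexive (sym (unitsBefore-hit τ i j t (σ⊆τ t ℕ.≤-refl hit) r≤t))))

-- Each step serves at most one index, and neither job gains a unit before `release j`, so the two
-- counts share the steps from `release j` up to `t`.
unitsBefore-disjoint : ∀ σ i j i′ j′ t → i ≢ i′ → release j ℕ.≤ release j′ →
  unitsBefore σ i j t ℕ.+ unitsBefore σ i′ j′ t ℕ.≤ t ∸ release j
unitsBefore-disjoint σ i j i′ j′ zero i≢i′ r≤r′ = z≤n
unitsBefore-disjoint σ i j i′ j′ (suc t) i≢i′ r≤r′
  with unitsBefore-step σ i j t | unitsBefore-step σ i′ j′ t | unitsBefore-disjoint σ i j i′ j′ t i≢i′ r≤r′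
... | inj₁ eq | inj₁ eq′ | ih rewrite eq | eq′ = ℕ.≤-trans ih (ℕ.∸-monoˡ-≤ (release j) (ℕ.n≤1+n t))
... | inj₁ eq | inj₂ (_ , r′≤t , eq′) | ih
  rewrite eq | eq′ | ℕ.+-suc (unitsBefore σ i j t) (unitsBefore σ i′ j′ t)
        | ℕ.+-∸-assoc 1 (ℕ.≤-trans r≤r′ r′≤t) = s≤s ih
... | inj₂ (_ , r≤t , eq) | inj₁ eq′ | ih
  rewrite eq | eq′ | ℕ.+-∸-assoc 1 r≤t = s≤s ih
... | inj₂ (hit , _) | inj₂ (hit′ , _) | _ =
  contradiction (just-injective (trans (sym hit) hit′)) i≢i′

-- Value of a schedule

data At : Instance → ℕ → Job → Set where
  here  : At (j ∷ I) zero j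
  there : At I i j → At (j′ ∷ I) (suc i) j

At-functional : At I i j → At I i j′ → j ≡ j′
At-functional here      here      = refl
At-functional (there p) (there q) = At-functional p q

At-length : ∀ I → At (I ∷ʳ j) (length I) j
At-length []      = here
At-length (_ ∷ I) = there (At-length I)

At-∷ʳ⁺ : At I i j → At (I ∷ʳ j′) i j
At-∷ʳ⁺ here      = here
At-∷ʳ⁺ (there p) = there (At-∷ʳ⁺ p)

At-∷ʳ⁻ : ∀ I → At (I ∷ʳ j′) i j → At I i j ⊎ (i ≡ length I × j ≡ j′)
At-∷ʳ⁻ []      here      = inj₂ (refl , refl)
At-∷ʳ⁻ (_ ∷ I) here      = inj₁ here
At-∷ʳ⁻ (_ ∷ I) (there p) with At-∷ʳ⁻ I p
... | inj₁ q             = inj₁ (there q)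
... | inj₂ (refl , refl) = inj₂ (refl , refl)

At-< : At I i j → i ℕ.< length I
At-< here      = s≤s z≤n
At-< (there p) = s≤s (At-< p)

-- `valueFrom` numbers the jobs of `I` from `o` on, so the job at position `i` has index `i + o` in
-- the schedule.
valueFrom-none : ∀ o → (∀ {i j} → At I i j → units σ (i ℕ.+ o) j ℕ.< processing j) → valueFrom σ o I ≡ 0
valueFrom-none {[]} o missed = refl
valueFrom-none {j ∷ I} {σ} o missed with processing j ≤? units σ o j
... | yes p≤u = contradiction p≤u (ℕ.<⇒≱ (missed here))
... | no _    = valueFrom-none (suc o) λ {i} {j} p →
  subst (λ x → units σ x j ℕ.< processing j) (sym (ℕ.+-suc i o)) (missed (there p))

valueFrom-one : ∀ {k} o a → ValidInstance k I →
  (∀ {i j} → At I i j → i ≢ a → units σ (i ℕ.+ o) j ℕ.< processing j) → valueFrom σ o I ℕ.≤ 1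
valueFrom-one {[]} o a _ missed = z≤n
valueFrom-one {j ∷ I} {σ} o zero ((w≡1 , _) ∷ _) missed
  with processing j ≤? units σ o j
     | valueFrom-none {I} {σ} (suc o) (λ {i} {j} p →
         subst (λ x → units σ x j ℕ.< processing j) (sym (ℕ.+-suc i o)) (missed (there p) λ ()))
... | yes _ | eq rewrite w≡1 | eq = ℕ.≤-refl
... | no _  | eq rewrite eq = z≤n
valueFrom-one {j ∷ I} {σ} o (suc a) (_ ∷ valid) missed with processing j ≤? units σ o j
... | yes p≤u = contradiction p≤u (ℕ.<⇒≱ (missed here λ ()))
... | no _    = valueFrom-one (suc o) a valid λ {i} {j} p i≢a →
  subst (λ x → units σ x j ℕ.< processing j) (sym (ℕ.+-suc i o)) (missed (there p) (i≢a ∘ ℕ.suc-injective))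

valueFrom-done : ∀ σ o j I → processing j ℕ.≤ units σ o j →
  valueFrom σ o (j ∷ I) ≡ weight j ℕ.+ valueFrom σ (suc o) I
valueFrom-done σ o j I done with processing j ≤? units σ o j
... | yes _     = refl
... | no ¬done  = contradiction done ¬done

valueFrom-tail : ∀ σ o j I → valueFrom σ (suc o) I ℕ.≤ valueFrom σ o (j ∷ I)
valueFrom-tail σ o j I with processing j ≤? units σ o j
... | yes _ = ℕ.m≤n+m _ (weight j)
... | no _  = ℕ.≤-refl

valueFrom-suffix : ∀ σ o I J → valueFrom σ (length I ℕ.+ o) J ℕ.≤ valueFrom σ o (I ++ J)
valueFrom-suffix σ o []      J = ℕ.≤-refl
valueFrom-suffix σ o (j ∷ I) J = ℕ.≤-trans
  (ℕ.≤-reflexive (cong (λ x → valueFrom σ x J) (sym (ℕ.+-suc (length I) o))))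
  (ℕ.≤-trans (valueFrom-suffix σ (suc o) I J) (valueFrom-tail σ o j (I ++ J)))

-- This is what lets `fill` insert a job into idle steps without losing any job completed before.
valueFrom-mono-schedule : ∀ o I → (∀ s {i} → σ s ≡ just i → τ s ≡ just i) →
  valueFrom σ o I ℕ.≤ valueFrom τ o I
valueFrom-mono-schedule o [] σ⊆τ = z≤n
valueFrom-mono-schedule {σ} {τ} o (j ∷ I) σ⊆τ
  with processing j ≤? units σ o j | processing j ≤? units τ o j
... | yes _ | yes _ = ℕ.+-monoʳ-≤ (weight j) (valueFrom-mono-schedule (suc o) I σ⊆τ)
... | yes p | no ¬p = contradiction
  (ℕ.≤-trans p (unitsBefore-mono-schedule o j (deadline j) λ s _ → σ⊆τ s)) ¬p
... | no _  | yes _ = ℕ.≤-trans (valueFrom-mono-schedule (suc o) I σ⊆τ) (ℕ.m≤n+m _ (weight j))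
... | no _  | no _  = valueFrom-mono-schedule (suc o) I σ⊆τ

AllJobs-++ : ∀ {P} → AllJobs P I → AllJobs P J → AllJobs P (I ++ J)
AllJobs-++ []       qs = qs
AllJobs-++ (p ∷ ps) qs = p ∷ AllJobs-++ ps qs

-- Filling the idle times of a schedule

IdleOutside : Schedule → ℕ → ℕ → Set
IdleOutside σ a b = ∀ s → s ℕ.< a ⊎ b ℕ.≤ s → σ s ≡ nothing

fillSlot : Maybe ℕ → ℕ → ℕ → ℕ → Schedule
fillSlot (just x) i a b s = just x
fillSlot nothing  i a b s with a ≤? s | s <? b
... | yes _ | yes _ = just i
... | _     | _     = nothing

fill : Schedule → ℕ → ℕ → ℕ → Schedule
fill σ i a b s = fillSlot (σ s) i a b s

fill-extends : ∀ σ i a b s {i′} → σ s ≡ just i′ → fill σ i a b s ≡ just i′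
fill-extends σ i a b s eq rewrite eq = refl

fill-idle : ∀ σ i a b s → σ s ≡ nothing → a ℕ.≤ s → s ℕ.< b → fill σ i a b s ≡ just i
fill-idle σ i a b s eq a≤s s<b rewrite eq with a ≤? s | s <? b
... | yes _ | yes _   = refl
... | yes _ | no s≮b  = contradiction s<b s≮b
... | no a≰s | _      = contradiction a≤s a≰s

IdleOutside-widen : ∀ {a b c d} → c ℕ.≤ a → b ℕ.≤ d → IdleOutside σ a b → IdleOutside σ c d
IdleOutside-widen c≤a b≤d idle s (inj₁ s<c) = idle s (inj₁ (ℕ.≤-trans s<c c≤a))
IdleOutside-widen c≤a b≤d idle s (inj₂ d≤s) = idle s (inj₂ (ℕ.≤-trans b≤d d≤s))

fill-outside : ∀ i {a b c d} → a ℕ.≤ c → d ℕ.≤ b → IdleOutside σ a b → IdleOutside (fill σ i c d) a b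
fill-outside i {a} {b} {c} {d} a≤c d≤b idle s out rewrite idle s out with c ≤? s | s <? d | out
... | yes c≤s | yes s<d | inj₁ s<a = contradiction (ℕ.≤-trans a≤c c≤s) (ℕ.<⇒≱ s<a)
... | yes c≤s | yes s<d | inj₂ b≤s = contradiction (ℕ.≤-trans d≤b b≤s) (ℕ.<⇒≱ s<d)
... | yes _   | no _    | _        = refl
... | no _    | _       | _        = refl

-- Online algorithms cannot see the future

known-∷ʳ : ∀ t I j → t ℕ.< release j → known t (I ∷ʳ j) ≡ known t I
known-∷ʳ t I j t<r = trans (filter-++ (λ j → release j ≤? t) I (j ∷ []))
  (trans (cong (known t I ++_) (filter-reject (λ j → release j ≤? t) (ℕ.<⇒≱ t<r))) (++-identityʳ _))

toOrig-∷ʳ : ∀ t I j n → t ℕ.< release j → toOrig t (I ∷ʳ j) n ≡ toOrig t I n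
toOrig-∷ʳ t [] j n t<r with release j ≤? t
... | yes r≤t = contradiction r≤t (ℕ.<⇒≱ t<r)
... | no _    = refl
toOrig-∷ʳ t (j′ ∷ I) j n t<r with release j′ ≤? t
toOrig-∷ʳ t (j′ ∷ I) j zero    t<r | yes _ = refl
toOrig-∷ʳ t (j′ ∷ I) j (suc n) t<r | yes _ = cong (Maybe.map suc) (toOrig-∷ʳ t I j n t<r)
toOrig-∷ʳ t (j′ ∷ I) j n       t<r | no _  = cong (Maybe.map suc) (toOrig-∷ʳ t I j n t<r)

-- Appending at the end of the list preserves the indices of the earlier jobs, so decisions taken
-- before the new release name the same jobs.
run-∷ʳ : ∀ A t I j → t ℕ.< release j → run A (I ∷ʳ j) t ≡ run A I t
run-∷ʳ A t I j t<r rewrite known-∷ʳ t I j t<r with A t (known t I)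
... | nothing = refl
... | just n  = toOrig-∷ʳ t I j n t<r

-- Jobs that can no longer be completed

-- Quantifying over all schedules with the same past makes the property survive the release of
-- further jobs at or after `t`.
Doomed : Schedule → ℕ → ℕ → Job → Set
Doomed σ t i j = ∀ τ → (∀ s → s ℕ.< t → τ s ≡ σ s) → units τ i j ℕ.< processing j

Doomed-intro : ∀ σ t i j → t ℕ.≤ deadline j →
  unitsBefore σ i j t ℕ.+ (deadline j ∸ t) ℕ.< processing j → Doomed σ t i j
Doomed-intro σ t i j t≤d short τ agree = begin-strict
  unitsBefore τ i j (deadline j)                    ≡⟨ cong (unitsBefore τ i j) (ℕ.m∸n+n≡m t≤d) ⟨
  unitsBefore τ i j (deadline j ∸ t ℕ.+ t)          ≤⟨ unitsBefore-+-≤ τ i j t (deadline j ∸ t) ⟩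
  deadline j ∸ t ℕ.+ unitsBefore τ i j t            ≤⟨ ℕ.+-monoʳ-≤ (deadline j ∸ t)
    (unitsBefore-mono-schedule i j t λ s s<t eq → trans (sym (agree s s<t)) eq) ⟩
  deadline j ∸ t ℕ.+ unitsBefore σ i j t            ≡⟨ ℕ.+-comm (deadline j ∸ t) _ ⟩
  unitsBefore σ i j t ℕ.+ (deadline j ∸ t)          <⟨ short ⟩
  processing j                                      ∎
  where open ℕ.≤-Reasoning

-- The job at position `a` may itself be lost already; it is merely the only one that can still
-- count.
Focused : OnlineAlgorithm → Instance → ℕ → ℕ → Set
Focused A I a t = ∀ {i j} → At I i j → i ≢ a → Doomed (run A I) t i j

Doomed-∷ʳ : ∀ {A} → t ℕ.≤ t′ → t ℕ.≤ release j′ → Doomed (run A I) t i j → Doomed (run A (I ∷ʳ j′)) t′ i j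
Doomed-∷ʳ {j′ = j′} {I = I} {A = A} t≤t′ t≤r doomed τ agree = doomed τ λ s s<t →
  trans (agree s (ℕ.≤-trans s<t t≤t′)) (run-∷ʳ A s I j′ (ℕ.≤-trans s<t t≤r))

Focused-single : ∀ {A} → Focused A (j ∷ []) 0 t
Focused-single here 0≢0 = contradiction refl 0≢0

-- The adversary's probes

unitJob : (p slack r : ℕ) → Job
unitJob p slack r = job r p (r ℕ.+ (p ℕ.+ slack)) 1

-- While the job at position a stays alive, A has spent at most s units elsewhere
-- since its release, so a probe of slack s′ is doomed s + s′ + 1 steps after its release.
probe-doomed : ∀ σ {a b r p s t q s′} → a ≢ b → r ℕ.≤ t → s ℕ.< q →
  t ℕ.+ suc (s ℕ.+ s′) ℕ.≤ r ℕ.+ (p ℕ.+ s) →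
  p ℕ.≤ unitsBefore σ a (unitJob p s r) (t ℕ.+ suc (s ℕ.+ s′)) ℕ.+ (r ℕ.+ (p ℕ.+ s) ∸ (t ℕ.+ suc (s ℕ.+ s′))) →
  Doomed σ (t ℕ.+ suc (s ℕ.+ s′)) b (unitJob q s′ t)
probe-doomed σ {a} {b} {r} {p} {s} {t} {q} {s′} a≢b r≤t s<q T≤d alive =
  -- After `T` only `q - s - 1` steps of the probe's window remain, so with at most `s` units
  -- received it ends at least one unit short. Adding `T` to both sides removes the truncated
  -- subtraction.
  Doomed-intro σ T b (unitJob q s′ t) T≤d′ (ℕ.+-cancelʳ-< T _ _ (begin-strict
    v ℕ.+ (t ℕ.+ (q ℕ.+ s′) ∸ T) ℕ.+ T    ≡⟨ ℕ.+-assoc v _ T ⟩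
    v ℕ.+ (t ℕ.+ (q ℕ.+ s′) ∸ T ℕ.+ T)    ≡⟨ cong (v ℕ.+_) (ℕ.m∸n+n≡m T≤d′) ⟩
    v ℕ.+ (t ℕ.+ (q ℕ.+ s′))              ≤⟨ ℕ.+-monoˡ-≤ _ v≤s ⟩
    s ℕ.+ (t ℕ.+ (q ℕ.+ s′))              <⟨ ℕ.≤-reflexive (arith s t q s′) ⟩
    q ℕ.+ T                               ∎))
  where
  open ℕ.≤-Reasoning
  T = t ℕ.+ suc (s ℕ.+ s′)
  u = unitsBefore σ a (unitJob p s r) T
  v = unitsBefore σ b (unitJob q s′ t) T
  arith : ∀ s t q s′ → suc (s ℕ.+ (t ℕ.+ (q ℕ.+ s′))) ≡ q ℕ.+ (t ℕ.+ suc (s ℕ.+ s′))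
  arith = solve-∀
  T≤d′ : T ℕ.≤ t ℕ.+ (q ℕ.+ s′)
  T≤d′ = ℕ.+-monoʳ-≤ t (ℕ.+-monoˡ-≤ s′ s<q)
  r≤T : r ℕ.≤ T
  r≤T = ℕ.≤-trans r≤t (ℕ.m≤m+n t _)
  v≤s : v ℕ.≤ s
  v≤s = ℕ.+-cancelˡ-≤ (u ℕ.+ r ℕ.+ p) _ _ (begin
    u ℕ.+ r ℕ.+ p ℕ.+ v                       ≡⟨ rearrange u r p v ⟩
    p ℕ.+ (u ℕ.+ v ℕ.+ r)                     ≤⟨ ℕ.+-monoʳ-≤ p (ℕ.+-monoˡ-≤ r (unitsBefore-disjoint σ a _ b _ T a≢b r≤t)) ⟩
    p ℕ.+ (T ∸ r ℕ.+ r)                       ≡⟨ cong (p ℕ.+_) (ℕ.m∸n+n≡m r≤T) ⟩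
    p ℕ.+ T                                   ≤⟨ ℕ.+-monoˡ-≤ T alive ⟩
    u ℕ.+ (r ℕ.+ (p ℕ.+ s) ∸ T) ℕ.+ T         ≡⟨ ℕ.+-assoc u _ T ⟩
    u ℕ.+ (r ℕ.+ (p ℕ.+ s) ∸ T ℕ.+ T)         ≡⟨ cong (u ℕ.+_) (ℕ.m∸n+n≡m T≤d) ⟩
    u ℕ.+ (r ℕ.+ (p ℕ.+ s))                   ≡⟨ rearrange′ u r p s ⟩
    u ℕ.+ r ℕ.+ p ℕ.+ s                       ∎)
    where
    rearrange : ∀ u r p v → u ℕ.+ r ℕ.+ p ℕ.+ v ≡ p ℕ.+ (u ℕ.+ v ℕ.+ r)
    rearrange = solve-∀
    rearrange′ : ∀ u r p s → u ℕ.+ (r ℕ.+ (p ℕ.+ s)) ≡ u ℕ.+ r ℕ.+ p ℕ.+ s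
    rearrange′ = solve-∀

module Probing (A : OnlineAlgorithm) (q s′ : ℕ) where

  len : ℕ
  len = q ℕ.+ s′

  probes : ℕ → ℕ → Instance
  probes zero    t = []
  probes (suc m) t = unitJob q s′ t ∷ probes m (t ℕ.+ len)

  probes-valid : ∀ {k} m t → 1 ℕ.≤ q → q ℕ.≤ k → ValidInstance k (probes m t)
  probes-valid zero    t 1≤q q≤k = []
  probes-valid (suc m) t 1≤q q≤k = (refl , 1≤q , q≤k) ∷ probes-valid m (t ℕ.+ len) 1≤q q≤k

  -- Each probe gets its whole window, slack included: the windows are disjoint and surplus units do
  -- no harm.
  serve : ℕ → ℕ → ℕ → Schedule
  serve zero    o t = λ _ → nothing
  serve (suc m) o t = fill (serve m (suc o) (t ℕ.+ len)) o t (t ℕ.+ len)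

  serve-outside : ∀ m o t → IdleOutside (serve m o t) t (t ℕ.+ m ℕ.* len)
  serve-outside zero    o t s _ = refl
  serve-outside (suc m) o t = fill-outside o ℕ.≤-refl (ℕ.+-monoʳ-≤ t (ℕ.m≤m+n len (m ℕ.* len)))
    (IdleOutside-widen (ℕ.m≤m+n t len) (ℕ.≤-reflexive (ℕ.+-assoc t len (m ℕ.* len)))
      (serve-outside m (suc o) (t ℕ.+ len)))

  serve-value : ∀ m o t → m ℕ.≤ valueFrom (serve m o t) o (probes m t)
  serve-value zero    o t = z≤n
  serve-value (suc m) o t = begin
    suc m                                   ≤⟨ s≤s (serve-value m (suc o) t⁺) ⟩
    suc (valueFrom rest (suc o) (probes m t⁺)) ≤⟨ s≤s (valueFrom-mono-schedule (suc o) (probes m t⁺) (fill-extends rest o t t⁺)) ⟩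
    suc (valueFrom all (suc o) (probes m t⁺))  ≡⟨ valueFrom-done all o W (probes m t⁺) done ⟨
    valueFrom all o (probes (suc m) t)      ∎
    where
    open ℕ.≤-Reasoning
    t⁺ = t ℕ.+ len
    W = unitJob q s′ t
    rest = serve m (suc o) t⁺
    all = serve (suc m) o t
    done : q ℕ.≤ units all o W
    done = begin
      q                                    ≤⟨ ℕ.m≤m+n q s′ ⟩
      len                                  ≤⟨ ℕ.m≤m+n len _ ⟩
      len ℕ.+ unitsBefore all o W t        ≤⟨ unitsBefore-busy all o W t len ℕ.≤-refl busy ⟩
      unitsBefore all o W (len ℕ.+ t)      ≡⟨ cong (unitsBefore all o W) (ℕ.+-comm len t) ⟩
      unitsBefore all o W (t ℕ.+ len)      ∎
      where
      busy : ∀ s → t ℕ.≤ s → s ℕ.< len ℕ.+ t → all s ≡ just o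
      busy s t≤s s< = fill-idle rest o t t⁺ s (serve-outside m (suc o) t⁺ s (inj₁ s<t⁺)) t≤s s<t⁺
        where s<t⁺ = subst (s ℕ.<_) (ℕ.+-comm len t) s<

  module Target (r p s : ℕ) (s<q : s ℕ.< q) where

    -- The algorithm gives up its target for the probe released at `t′`, after having let the
    -- earlier probes `J` pass. The bound on `t′ + len` keeps the window of this last probe inside
    -- the time reserved for all `m` probes.
    Switched : ℕ → Instance → ℕ → Set
    Switched m I t = ∃ λ J → ∃ λ t′ → t ℕ.≤ t′ × t′ ℕ.+ len ℕ.≤ t ℕ.+ m ℕ.* len ×
      (∀ {k} → 1 ℕ.≤ q → q ℕ.≤ k → ValidInstance k J) ×
      Focused A ((I ++ J) ∷ʳ unitJob q s′ t′) (length (I ++ J)) (t′ ℕ.+ suc (s ℕ.+ s′))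

    -- Induction on the number of probes. At time `T`, `s + s′ + 1` steps after a release, either
    -- the target can no longer be completed and the new probe is the only hope left, or the target
    -- is alive and `probe-doomed` rules out the probe, so the next one can be released.
    probe : ∀ m I a t → At I a (unitJob p s r) → r ℕ.≤ t → t ℕ.+ m ℕ.* len ℕ.≤ r ℕ.+ (p ℕ.+ s) →
      Focused A I a t → (∃ λ T → Focused A (I ++ probes m t) a T) ⊎ Switched m I t
    probe zero I a t at r≤t fits focused =
      inj₁ (t , subst (λ I → Focused A I a t) (sym (++-identityʳ I)) focused)
    probe (suc m) I a t at r≤t fits focused = decide
      (unitsBefore alg a X T ℕ.+ (r ℕ.+ (p ℕ.+ s) ∸ T) <? p)
      where
      X = unitJob p s r
      W = unitJob q s′ t
      I′ = I ∷ʳ W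
      alg = run A I′
      T = t ℕ.+ suc (s ℕ.+ s′)
      t⁺ = t ℕ.+ len
      T≤t⁺ : T ℕ.≤ t⁺
      T≤t⁺ = ℕ.+-monoʳ-≤ t (ℕ.+-monoˡ-≤ s′ s<q)
      T≤d : T ℕ.≤ r ℕ.+ (p ℕ.+ s)
      T≤d = ℕ.≤-trans T≤t⁺ (ℕ.≤-trans (ℕ.+-monoʳ-≤ t (ℕ.m≤m+n len (m ℕ.* len))) fits)
      shift : t⁺ ℕ.+ m ℕ.* len ≡ t ℕ.+ suc m ℕ.* len
      shift = ℕ.+-assoc t len (m ℕ.* len)
      a≢ : a ≢ length I
      a≢ refl = ℕ.<-irrefl refl (At-< at)
      old : ∀ {i j} T′ → t ℕ.≤ T′ → At I i j → i ≢ a → Doomed alg T′ i j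
      old {i} {j} T′ t≤T′ p i≢a = Doomed-∷ʳ {i = i} {j = j} {A = A} t≤T′ ℕ.≤-refl (focused p i≢a)
      extend : Switched m I′ t⁺ → Switched (suc m) I t
      extend (J , t′ , t⁺≤t′ , end , valid , focused′) =
        W ∷ J , t′ , ℕ.≤-trans (ℕ.m≤m+n t len) t⁺≤t′ , subst (t′ ℕ.+ len ℕ.≤_) shift end ,
        (λ 1≤q q≤k → (refl , 1≤q , q≤k) ∷ valid 1≤q q≤k) ,
        subst (λ I → Focused A (I ∷ʳ unitJob q s′ t′) (length I) _) (∷ʳ-++ I W J) focused′
      decide : _ → (∃ λ T → Focused A (I ++ probes (suc m) t) a T) ⊎ Switched (suc m) I t
      decide (yes short) = inj₂ ([] , t , ℕ.≤-refl , ℕ.+-monoʳ-≤ t (ℕ.m≤m+n len (m ℕ.* len)) , (λ _ _ → []) ,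
          subst (λ I → Focused A (I ∷ʳ W) (length I) T) (sym (++-identityʳ I)) focused′)
        where
        focused′ : Focused A I′ (length I) T
        focused′ {i} at′ i≢ with At-∷ʳ⁻ I at′ | i ≟ a
        ... | inj₂ (i≡ , _) | _        = contradiction i≡ i≢
        ... | inj₁ atI      | no i≢a   = old T (ℕ.m≤m+n t _) atI i≢a
        ... | inj₁ atI      | yes refl with At-functional atI at
        ...   | refl = Doomed-intro alg T a X T≤d short
      decide (no ¬short) with probe m I′ a t⁺ (At-∷ʳ⁺ at) (ℕ.≤-trans r≤t (ℕ.m≤m+n t len))
                                    (subst (ℕ._≤ r ℕ.+ (p ℕ.+ s)) (sym shift) fits) focused′
        where
        doomed : Doomed alg T (length I) W
        doomed = probe-doomed alg a≢ r≤t s<q T≤d (ℕ.≮⇒≥ ¬short)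
        focused′ : Focused A I′ a t⁺
        focused′ at′ i≢a with At-∷ʳ⁻ I at′
        ... | inj₁ atI           = old t⁺ (ℕ.m≤m+n t len) atI i≢a
        ... | inj₂ (refl , refl) = λ τ agree → doomed τ λ s s<T → agree s (ℕ.≤-trans s<T T≤t⁺)
      ... | inj₁ (T′ , focused″) = inj₁ (T′ , subst (λ I → Focused A I a T′) (∷ʳ-++ I W _) focused″)
      ... | inj₂ switched        = inj₂ (extend switched)

-- The job receives every step from its release to `b` except possibly the `s′` steps from `c` on,
-- which `σ` may occupy. Slack `s′` is thus enough to host `σ`.
unitsBefore-fill : ∀ σ i j {b c s′} →
  IdleOutside σ c (c ℕ.+ s′) → release j ℕ.≤ c → c ℕ.+ s′ ℕ.≤ b →
  b ℕ.≤ unitsBefore (fill σ i (release j) b) i j b ℕ.+ (release j ℕ.+ s′)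
unitsBefore-fill σ i j {b} {c} {s′} idle r≤c c+s′≤b = begin
  b                                                             ≡⟨ ℕ.m∸n+n≡m c+s′≤b ⟨
  after ℕ.+ (c ℕ.+ s′)                                          ≡⟨ cong (λ x → after ℕ.+ (x ℕ.+ s′)) (ℕ.m∸n+n≡m r≤c) ⟨
  after ℕ.+ (before ℕ.+ r ℕ.+ s′)                               ≡⟨ rearrange after before r s′ ⟩
  after ℕ.+ before ℕ.+ (r ℕ.+ s′)                               ≤⟨ ℕ.+-monoˡ-≤ (r ℕ.+ s′) enough ⟩
  units′ b ℕ.+ (r ℕ.+ s′)                                       ∎
  where
  open ℕ.≤-Reasoning
  r = release j
  filled = fill σ i r b
  units′ = unitsBefore filled i j
  before = c ∸ r
  after  = b ∸ (c ℕ.+ s′)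
  rearrange : ∀ x y r s → x ℕ.+ (y ℕ.+ r ℕ.+ s) ≡ x ℕ.+ y ℕ.+ (r ℕ.+ s)
  rearrange = solve-∀
  busy-before : ∀ s → r ℕ.≤ s → s ℕ.< before ℕ.+ r → filled s ≡ just i
  busy-before s r≤s s< = fill-idle σ i r b s (idle s (inj₁ s<c)) r≤s
    (ℕ.≤-trans s<c (ℕ.≤-trans (ℕ.m≤m+n c s′) c+s′≤b))
    where s<c = subst (s ℕ.<_) (ℕ.m∸n+n≡m r≤c) s<
  busy-after : ∀ s → c ℕ.+ s′ ℕ.≤ s → s ℕ.< after ℕ.+ (c ℕ.+ s′) → filled s ≡ just i
  busy-after s e≤s s< = fill-idle σ i r b s (idle s (inj₂ e≤s))
    (ℕ.≤-trans r≤c (ℕ.≤-trans (ℕ.m≤m+n c s′) e≤s)) (subst (s ℕ.<_) (ℕ.m∸n+n≡m c+s′≤b) s<)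
  enough : after ℕ.+ before ℕ.≤ units′ b
  enough = begin
    after ℕ.+ before                    ≤⟨ ℕ.+-monoʳ-≤ after (ℕ.m≤m+n before _) ⟩
    after ℕ.+ (before ℕ.+ units′ r)     ≤⟨ ℕ.+-monoʳ-≤ after (unitsBefore-busy filled i j r before ℕ.≤-refl busy-before) ⟩
    after ℕ.+ units′ (before ℕ.+ r)     ≡⟨ cong (λ x → after ℕ.+ units′ x) (ℕ.m∸n+n≡m r≤c) ⟩
    after ℕ.+ units′ c                  ≤⟨ ℕ.+-monoʳ-≤ after (unitsBefore-mono-+ filled i j c s′) ⟩
    after ℕ.+ units′ (s′ ℕ.+ c)         ≡⟨ cong (λ x → after ℕ.+ units′ x) (ℕ.+-comm s′ c) ⟩
    after ℕ.+ units′ (c ℕ.+ s′)         ≤⟨ unitsBefore-busy filled i j (c ℕ.+ s′) after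
      (ℕ.≤-trans r≤c (ℕ.m≤m+n c s′)) busy-after ⟩
    units′ (after ℕ.+ (c ℕ.+ s′))       ≡⟨ cong units′ (ℕ.m∸n+n≡m c+s′≤b) ⟩
    units′ b                            ∎

-- The nested construction

module Adversary (A : OnlineAlgorithm) (k N : ℕ) (1≤N : 1 ℕ.≤ N) where

  -- The slack of level `suc n` is one window of level `n`, room for the nested schedule. The other
  -- sizes make the probes fit exactly: after the `suc (slack (suc n))` steps that establish focus,
  -- `N` baits fill the rest of a main window, and after the first `suc (window n)` steps of a bait,
  -- `N` windows of level `n` fill its remainder.
  mutual
    proc : ℕ → ℕ
    proc zero    = 1
    proc (suc n) = suc (N ℕ.* bait n)

    slack : ℕ → ℕ
    slack zero    = 0
    slack (suc n) = window n

    window : ℕ → ℕ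
    window n = proc n ℕ.+ slack n

    bait : ℕ → ℕ
    bait n = suc (suc N ℕ.* window n)

  1≤proc : ∀ n → 1 ℕ.≤ proc n
  1≤proc zero    = s≤s z≤n
  1≤proc (suc n) = s≤s z≤n

  bait≤window : ∀ n → bait n ℕ.≤ window (suc n)
  bait≤window n = begin
    bait n              ≡⟨ ℕ.*-identityˡ (bait n) ⟨
    1 ℕ.* bait n        ≤⟨ ℕ.*-monoˡ-≤ (bait n) 1≤N ⟩
    N ℕ.* bait n        ≤⟨ ℕ.n≤1+n _ ⟩
    proc (suc n)        ≤⟨ ℕ.m≤m+n _ _ ⟩
    window (suc n)      ∎
    where open ℕ.≤-Reasoning

  main : ℕ → ℕ → Job
  main n = unitJob (proc n) (slack n)

  -- Only the main job and the jobs after it are counted, and `σ` stays inside the main window, so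
  -- an enclosing level can add its own main job in the remaining steps.
  Outcome : ℕ → Instance → ℕ → Set
  Outcome n I r = ∃ λ J → ValidInstance k (main n r ∷ J) ×
    (∃ λ a → ∃ λ T → Focused A (I ++ main n r ∷ J) a T) ×
    (∃ λ σ → IdleOutside σ r (r ℕ.+ window n) × n ℕ.≤ valueFrom σ (length I) (main n r ∷ J))

  -- Induction on the level. If one of the two rounds of probes is ignored, all `N` probes are
  -- served, and `n ≤ N` makes that enough. If the algorithm switches in both rounds, the nested
  -- attack contributes one job per lower level and the main job of this level is completed on top.
  attack : ∀ n → n ℕ.≤ N → window n ℕ.≤ k → ∀ I r →
    Focused A (I ∷ʳ main n r) (length I) (r ℕ.+ suc (slack n)) → Outcome n I r
  -- No job is required at level 0, so the idle schedule suffices; since `window 0` is 1, `w≤k` also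
  -- bounds the processing time of the main job.
  attack zero n≤N w≤k I r focused =
    [] , (refl , ℕ.≤-refl , w≤k) ∷ [] , (length I , _ , focused) , (λ _ → nothing) , (λ _ _ → refl) , z≤n
  attack (suc n) n<N w≤k I r focused = stage₁
    (Baits.probe N I₁ (length I) t₁ (At-length I) (ℕ.m≤m+n r _) fits₁ focused)
    where
    open ℕ.≤-Reasoning
    X = main (suc n) r
    I₁ = I ∷ʳ X
    t₁ = r ℕ.+ suc (window n)
    d = r ℕ.+ window (suc n)
    module P₁ = Probing A (bait n) 0
    window<bait : window n ℕ.< bait n
    window<bait = s≤s (ℕ.m≤m+n (window n) (N ℕ.* window n))
    module Baits = P₁.Target r (proc (suc n)) (window n) window<bait
    bait≤k : bait n ℕ.≤ k
    bait≤k = ℕ.≤-trans (bait≤window n) w≤k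
    proc≤k : proc n ℕ.≤ k
    proc≤k = ℕ.≤-trans (ℕ.m≤m+n (proc n) (slack n))
      (ℕ.≤-trans (ℕ.m≤n+m (window n) (proc (suc n))) w≤k)
    validX : UnitJobMaxK k X
    validX = refl , s≤s z≤n , ℕ.≤-trans (ℕ.m≤m+n (proc (suc n)) _) w≤k
    fits₁ : t₁ ℕ.+ N ℕ.* P₁.len ℕ.≤ d
    fits₁ = ℕ.≤-reflexive (arith r N (window n) (bait n))
      where
      arith : ∀ r N w b → r ℕ.+ suc w ℕ.+ N ℕ.* (b ℕ.+ 0) ≡ r ℕ.+ (suc (N ℕ.* b) ℕ.+ w)
      arith = solve-∀

    stage₁ : _ → Outcome (suc n) I r
    stage₁ (inj₁ (T , focused₁)) =
      baits , validX ∷ P₁.probes-valid N t₁ (s≤s z≤n) bait≤k ,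
      (length I , T , subst (λ I → Focused A I _ T) (∷ʳ-++ I X baits) focused₁) ,
      P₁.serve N (suc (length I)) t₁ ,
      IdleOutside-widen (ℕ.m≤m+n r _) fits₁ (P₁.serve-outside N (suc (length I)) t₁) ,
      ℕ.≤-trans n<N (ℕ.≤-trans (P₁.serve-value N (suc (length I)) t₁)
        (valueFrom-tail _ (length I) X baits))
      where baits = P₁.probes N t₁
    stage₁ (inj₂ (J₁ , r₂ , t₁≤r₂ , end₁ , valid₁ , focused₁)) = stage₂
      (Mains.probe N I₂ (length (I₁ ++ J₁)) t₂ (At-length (I₁ ++ J₁)) (ℕ.m≤m+n r₂ _) fits₂ focused₁)
      where
      Z = unitJob (bait n) 0 r₂
      I₂ = (I₁ ++ J₁) ∷ʳ Z
      t₂ = r₂ ℕ.+ suc (window n ℕ.+ 0)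
      -- The roles shift: the tight bait `Z` becomes the target and main jobs of level `n` become
      -- the probes. As the target has slack 0, a switch gives focus `suc (slack n)` steps after the
      -- release, just as `attack n` expects.
      module P₂ = Probing A (proc n) (slack n)
      module Mains = P₂.Target r₂ (bait n) 0 (1≤proc n)
      fits₂ : t₂ ℕ.+ N ℕ.* P₂.len ℕ.≤ r₂ ℕ.+ (bait n ℕ.+ 0)
      fits₂ = ℕ.≤-reflexive (arith r₂ N (window n))
        where
        arith : ∀ r N w → r ℕ.+ suc (w ℕ.+ 0) ℕ.+ N ℕ.* w ≡ r ℕ.+ (suc (w ℕ.+ N ℕ.* w) ℕ.+ 0)
        arith = solve-∀
      Zend≤d : r₂ ℕ.+ (bait n ℕ.+ 0) ℕ.≤ d
      Zend≤d = ℕ.≤-trans end₁ fits₁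
      r≤t₂ : r ℕ.≤ t₂
      r≤t₂ = ℕ.≤-trans (ℕ.m≤m+n r _) (ℕ.≤-trans t₁≤r₂ (ℕ.m≤m+n r₂ _))
      validZ : ValidInstance k (J₁ ++ Z ∷ [])
      validZ = AllJobs-++ (valid₁ (s≤s z≤n) bait≤k) ((refl , s≤s z≤n , bait≤k) ∷ [])

      I₂-split : I₂ ≡ I ++ X ∷ (J₁ ∷ʳ Z)
      I₂-split = trans (++-assoc I₁ J₁ (Z ∷ [])) (∷ʳ-++ I X (J₁ ∷ʳ Z))

      split : ∀ J → I₂ ++ J ≡ I ++ X ∷ ((J₁ ∷ʳ Z) ++ J)
      split J = trans (cong (_++ J) I₂-split) (++-assoc I (X ∷ (J₁ ∷ʳ Z)) J)

      suffix : ∀ σ J → valueFrom σ (length I₂) J ℕ.≤ valueFrom σ (suc (length I)) ((J₁ ∷ʳ Z) ++ J)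
      suffix σ J = subst (λ o → valueFrom σ o J ℕ.≤ valueFrom σ (suc (length I)) ((J₁ ∷ʳ Z) ++ J)) offset
        (valueFrom-suffix σ (suc (length I)) (J₁ ∷ʳ Z) J)
        where
        offset : length (J₁ ∷ʳ Z) ℕ.+ suc (length I) ≡ length I₂
        offset = trans (ℕ.+-suc (length (J₁ ∷ʳ Z)) (length I)) (trans (ℕ.+-comm (suc (length (J₁ ∷ʳ Z))) (length I))
          (sym (trans (cong length I₂-split) (length-++ I))))

      stage₂ : _ → Outcome (suc n) I r
      stage₂ (inj₁ (T , focused₂)) =
        (J₁ ∷ʳ Z) ++ mains , validX ∷ AllJobs-++ validZ (P₂.probes-valid N t₂ (1≤proc n) proc≤k) ,
        (_ , T , subst (λ I → Focused A I _ T) (split mains) focused₂) ,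
        P₂.serve N (length I₂) t₂ ,
        IdleOutside-widen r≤t₂ (ℕ.≤-trans fits₂ Zend≤d) (P₂.serve-outside N (length I₂) t₂) ,
        ℕ.≤-trans n<N (ℕ.≤-trans (P₂.serve-value N (length I₂) t₂)
          (ℕ.≤-trans (suffix _ mains) (valueFrom-tail _ (length I) X _)))
        where mains = P₂.probes N t₂
      stage₂ (inj₂ (J₂ , r₃ , t₂≤r₃ , end₂ , valid₂ , focused₂)) = stage₃
        (attack n (ℕ.<⇒≤ n<N) (ℕ.≤-trans (ℕ.m≤n+m (window n) (proc (suc n))) w≤k) (I₂ ++ J₂) r₃ focused₂)
        where
        r≤r₃ : r ℕ.≤ r₃
        r≤r₃ = ℕ.≤-trans r≤t₂ t₂≤r₃
        end≤d : r₃ ℕ.+ window n ℕ.≤ d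
        end≤d = ℕ.≤-trans end₂ (ℕ.≤-trans fits₂ Zend≤d)
        stage₃ : Outcome n (I₂ ++ J₂) r₃ → Outcome (suc n) I r
        stage₃ (J₃ , valid₃ , (a , T , focused₃) , σ₃ , idle , n≤value) =
          (J₁ ∷ʳ Z) ++ J₂ ++ Y ∷ J₃ ,
          validX ∷ AllJobs-++ validZ (AllJobs-++ (valid₂ (1≤proc n) proc≤k) valid₃) ,
          (a , T , subst (λ I → Focused A I a T)
            (trans (++-assoc I₂ J₂ (Y ∷ J₃)) (split (J₂ ++ Y ∷ J₃))) focused₃) ,
          filled , fill-outside (length I) ℕ.≤-refl ℕ.≤-refl (IdleOutside-widen r≤r₃ end≤d idle) , value≥
          where
          Y = main n r₃
          -- All baits are abandoned. `X` runs whenever `σ₃` idles in its window and loses at most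
          -- `window n` steps, which is exactly its slack.
          filled = fill σ₃ (length I) r d
          done : proc (suc n) ℕ.≤ units filled (length I) X
          done = ℕ.+-cancelʳ-≤ (r ℕ.+ window n) _ _ (begin
            proc (suc n) ℕ.+ (r ℕ.+ window n)    ≡⟨ rearrange (proc (suc n)) r (window n) ⟩
            d                                    ≤⟨ unitsBefore-fill σ₃ (length I) X idle r≤r₃ end≤d ⟩
            units filled (length I) X ℕ.+ (r ℕ.+ window n) ∎)
            where
            rearrange : ∀ p r w → p ℕ.+ (r ℕ.+ w) ≡ r ℕ.+ (p ℕ.+ w)
            rearrange = solve-∀
          value≥ : suc n ℕ.≤ valueFrom filled (length I) (X ∷ (J₁ ∷ʳ Z) ++ J₂ ++ Y ∷ J₃)
          value≥ = begin
            suc n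
              ≤⟨ s≤s n≤value ⟩
            suc (valueFrom σ₃ (length (I₂ ++ J₂)) (Y ∷ J₃))
              ≤⟨ s≤s (valueFrom-mono-schedule (length (I₂ ++ J₂)) (Y ∷ J₃) (fill-extends σ₃ (length I) r d)) ⟩
            suc (valueFrom filled (length (I₂ ++ J₂)) (Y ∷ J₃))
              ≡⟨ cong (λ o → suc (valueFrom filled o (Y ∷ J₃)))
                   (trans (length-++ I₂) (ℕ.+-comm (length I₂) (length J₂))) ⟩
            suc (valueFrom filled (length J₂ ℕ.+ length I₂) (Y ∷ J₃))
              ≤⟨ s≤s (valueFrom-suffix filled (length I₂) J₂ (Y ∷ J₃)) ⟩
            suc (valueFrom filled (length I₂) (J₂ ++ Y ∷ J₃))
              ≤⟨ s≤s (suffix filled (J₂ ++ Y ∷ J₃)) ⟩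
            suc (valueFrom filled (suc (length I)) ((J₁ ∷ʳ Z) ++ J₂ ++ Y ∷ J₃))
              ≡⟨ valueFrom-done filled (length I) X _ done ⟨
            valueFrom filled (length I) (X ∷ (J₁ ∷ʳ Z) ++ J₂ ++ Y ∷ J₃) ∎

  1≤window : ∀ n → 1 ℕ.≤ window n
  1≤window n = ℕ.≤-trans (1≤proc n) (ℕ.m≤m+n (proc n) (slack n))

  window≤ : ∀ n → window n ℕ.≤ ((2 ℕ.+ N) ℕ.^ 2) ℕ.^ n
  window≤ zero    = ℕ.≤-refl
  window≤ (suc n) = begin
    suc (N ℕ.* suc (suc N ℕ.* window n)) ℕ.+ window n        ≡⟨ expand N (window n) ⟩
    -- The constant term is absorbed using `1 ≤ window n`, giving the factor `N² + 2N + 2`; adding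
    -- `2N + 2` completes the square `(N + 2)²`.
    suc N ℕ.* 1 ℕ.+ (N ℕ.* N ℕ.+ N ℕ.+ 1) ℕ.* window n       ≤⟨ ℕ.+-monoˡ-≤ _ (ℕ.*-monoʳ-≤ (suc N) (1≤window n)) ⟩
    suc N ℕ.* window n ℕ.+ (N ℕ.* N ℕ.+ N ℕ.+ 1) ℕ.* window n ≤⟨ ℕ.m≤m+n _ ((2 ℕ.* N ℕ.+ 2) ℕ.* window n) ⟩
    suc N ℕ.* window n ℕ.+ (N ℕ.* N ℕ.+ N ℕ.+ 1) ℕ.* window n ℕ.+ (2 ℕ.* N ℕ.+ 2) ℕ.* window n ≡⟨ collect N (window n) ⟩
    (2 ℕ.+ N) ℕ.^ 2 ℕ.* window n                             ≤⟨ ℕ.*-monoʳ-≤ ((2 ℕ.+ N) ℕ.^ 2) (window≤ n) ⟩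
    (2 ℕ.+ N) ℕ.^ 2 ℕ.* ((2 ℕ.+ N) ℕ.^ 2) ℕ.^ n              ∎
    where
    open ℕ.≤-Reasoning
    expand : ∀ N w → suc (N ℕ.* suc (suc N ℕ.* w)) ℕ.+ w ≡ suc N ℕ.* 1 ℕ.+ (N ℕ.* N ℕ.+ N ℕ.+ 1) ℕ.* w
    expand = solve-∀
    collect : ∀ N w → suc N ℕ.* w ℕ.+ (N ℕ.* N ℕ.+ N ℕ.+ 1) ℕ.* w ℕ.+ (2 ℕ.* N ℕ.+ 2) ℕ.* w ≡ (2 ℕ.+ N) ℕ.* ((2 ℕ.+ N) ℕ.* 1) ℕ.* w
    collect = solve-∀

  -- The attack starts at level `N` with a lone main job, on which the algorithm is trivially
  -- focused. At the end `Doomed` is applied to the run itself, leaving at most one completed job.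
  hardInstance : ((2 ℕ.+ N) ℕ.^ 2) ℕ.^ N ℕ.≤ k →
    ∃ λ I → ∃ λ σ → ValidInstance k I × value (run A I) I ℕ.≤ 1 × N ℕ.≤ value σ I
  hardInstance bound with attack N ℕ.≤-refl (ℕ.≤-trans (window≤ N) bound) [] 0 (Focused-single {A = A})
  ... | J , valid , (a , T , focused) , σ , _ , N≤value =
    main N 0 ∷ J , σ , valid ,
    valueFrom-one 0 a valid (λ {i} {j} at i≢a →
      subst (λ x → units (run A (main N 0 ∷ J)) x j ℕ.< processing j) (sym (ℕ.+-identityʳ i))
        (focused at i≢a _ λ _ _ → refl)) ,
    N≤value

-- Logarithms and the choice of parameters

-- Halving `n` lowers its logarithm by one, which drives the induction on `e`.
2^e≤n : ∀ e n .{{_ : NonZero n}} → e ℕ.≤ ⌊log₂ n ⌋ → 2 ℕ.^ e ℕ.≤ n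
2^e≤n zero    (suc n)           _    = s≤s z≤n
2^e≤n (suc e) n@(suc (suc m)) e<log = begin
  2 ℕ.* 2 ℕ.^ e          ≤⟨ ℕ.*-monoʳ-≤ 2 (2^e≤n e ℕ.⌊ n /2⌋ e≤log) ⟩
  2 ℕ.* ℕ.⌊ n /2⌋        ≡⟨ cong (ℕ.⌊ n /2⌋ ℕ.+_) (ℕ.+-identityʳ _) ⟩
  ℕ.⌊ n /2⌋ ℕ.+ ℕ.⌊ n /2⌋ ≤⟨ ℕ.+-monoʳ-≤ ℕ.⌊ n /2⌋ (ℕ.⌊n/2⌋≤⌈n/2⌉ n) ⟩
  ℕ.⌊ n /2⌋ ℕ.+ ℕ.⌈ n /2⌉ ≡⟨ ℕ.⌊n/2⌋+⌈n/2⌉≡n n ⟩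
  n                      ∎
  where
  open ℕ.≤-Reasoning
  e≤log : e ℕ.≤ ⌊log₂ ℕ.⌊ n /2⌋ ⌋
  e≤log = subst (e ℕ.≤_) (sym (⌊log₂⌊n/2⌋⌋≡⌊log₂n⌋∸1 n)) (ℕ.∸-monoˡ-≤ 1 e<log)

e≤⌊log₂n⌋ : ∀ e {n} → 2 ℕ.^ e ℕ.≤ n → e ℕ.≤ ⌊log₂ n ⌋
e≤⌊log₂n⌋ e {n} 2^e≤n = subst (ℕ._≤ ⌊log₂ n ⌋) (⌊log₂[2^n]⌋≡n e) (⌊log₂⌋-mono-≤ 2^e≤n)

≥2^e⇒nonZero : ∀ e {n} → 2 ℕ.^ e ℕ.≤ n → NonZero n
≥2^e⇒nonZero e 2^e≤n = ℕ.>-nonZero (ℕ.≤-trans (ℕ.m^n>0 2 e) 2^e≤n)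

2^⌊log₂n⌋≤n : ∀ n .{{_ : NonZero n}} → 2 ℕ.^ ⌊log₂ n ⌋ ℕ.≤ n
2^⌊log₂n⌋≤n n = 2^e≤n ⌊log₂ n ⌋ n ℕ.≤-refl

n<2^[1+⌊log₂n⌋] : ∀ n → n ℕ.< 2 ℕ.^ suc ⌊log₂ n ⌋
n<2^[1+⌊log₂n⌋] n = ℕ.≰⇒> λ 2^≤n → ℕ.1+n≰n (e≤⌊log₂n⌋ (suc ⌊log₂ n ⌋) 2^≤n)

-- Equality holds at 4. Applied to a logarithm, it ensures that the quotient chosen as `N` is at
-- least 1.
4*n≤2^n : ∀ {n} → 4 ℕ.≤ n → 4 ℕ.* n ℕ.≤ 2 ℕ.^ n
4*n≤2^n {n} 4≤n = subst (λ n → 4 ℕ.* n ℕ.≤ 2 ℕ.^ n) (ℕ.m∸n+n≡m 4≤n) (go (n ∸ 4))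
  where
  open ℕ.≤-Reasoning
  go : ∀ m → 4 ℕ.* (m ℕ.+ 4) ℕ.≤ 2 ℕ.^ (m ℕ.+ 4)
  go zero    = ℕ.≤-refl
  go (suc m) = begin
    4 ℕ.* suc (m ℕ.+ 4)               ≤⟨ ℕ.*-monoʳ-≤ 4 (ℕ.+-monoˡ-≤ (m ℕ.+ 4) (ℕ.≤-trans (s≤s z≤n) (ℕ.m≤n+m 4 m))) ⟩
    4 ℕ.* ((m ℕ.+ 4) ℕ.+ (m ℕ.+ 4))   ≡⟨ double (m ℕ.+ 4) ⟩
    2 ℕ.* (4 ℕ.* (m ℕ.+ 4))           ≤⟨ ℕ.*-monoʳ-≤ 2 (go m) ⟩
    2 ℕ.^ suc (m ℕ.+ 4)               ∎
    where
    double : ∀ x → 4 ℕ.* (x ℕ.+ x) ≡ 2 ℕ.* (4 ℕ.* x)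
    double = solve-∀

-- `N` is `ℓ / (4 * ƛ)` rounded down, where `ƛ` is the logarithm of `ℓ`. The factor 4 pays for the
-- square and for replacing `1 + ƛ` by `2 * ƛ`; rounding down costs another factor 2, whence the 8.
parameter : ∀ ℓ → 16 ℕ.≤ ℓ → ∃ λ N → 1 ℕ.≤ N ×
  ((2 ℕ.+ N) ℕ.^ 2) ℕ.^ N ℕ.≤ 2 ℕ.^ ℓ × ℓ ℕ.≤ 8 ℕ.* (N ℕ.* ⌊log₂ ℓ ⌋)
parameter ℓ@(suc _) 16≤ℓ = N , 1≤N , bound , ℓ≤
  where
  open ℕ.≤-Reasoning
  ƛ = ⌊log₂ ℓ ⌋
  4≤ƛ : 4 ℕ.≤ ƛ
  4≤ƛ = ⌊log₂⌋-mono-≤ 16≤ℓ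
  instance
    4ƛ≢0 : NonZero (4 ℕ.* ƛ)
    4ƛ≢0 = ℕ.>-nonZero (ℕ.≤-trans (s≤s z≤n) (ℕ.*-monoʳ-≤ 4 4≤ƛ))
  N = ℓ ℕ./ (4 ℕ.* ƛ)
  4ƛ≤ℓ : 4 ℕ.* ƛ ℕ.≤ ℓ
  4ƛ≤ℓ = ℕ.≤-trans (4*n≤2^n 4≤ƛ) (2^⌊log₂n⌋≤n ℓ)
  1≤N : 1 ℕ.≤ N
  1≤N = m≥n⇒m/n>0 4ƛ≤ℓ
  N4ƛ≤ℓ : N ℕ.* (4 ℕ.* ƛ) ℕ.≤ ℓ
  N4ƛ≤ℓ = m/n*n≤m ℓ (4 ℕ.* ƛ)
  1≤ƛ : 1 ℕ.≤ ƛ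
  1≤ƛ = ℕ.≤-trans (s≤s z≤n) 4≤ƛ
  2+N≤ℓ : 2 ℕ.+ N ℕ.≤ ℓ
  2+N≤ℓ = begin
    2 ℕ.+ N               ≤⟨ ℕ.+-monoˡ-≤ N (ℕ.*-monoʳ-≤ 2 1≤N) ⟩
    2 ℕ.* N ℕ.+ N         ≤⟨ ℕ.m≤m+n _ N ⟩
    2 ℕ.* N ℕ.+ N ℕ.+ N   ≡⟨ collect N ⟩
    N ℕ.* (4 ℕ.* 1)       ≤⟨ ℕ.*-monoʳ-≤ N (ℕ.*-monoʳ-≤ 4 1≤ƛ) ⟩
    N ℕ.* (4 ℕ.* ƛ)       ≤⟨ N4ƛ≤ℓ ⟩
    ℓ                     ∎
    where
    collect : ∀ N → 2 ℕ.* N ℕ.+ N ℕ.+ N ≡ N ℕ.* (4 ℕ.* 1)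
    collect = solve-∀
  bound : ((2 ℕ.+ N) ℕ.^ 2) ℕ.^ N ℕ.≤ 2 ℕ.^ ℓ
  -- Since `2 + N ≤ ℓ < 2 ^ suc ƛ`, it remains to compare exponents of 2.
  bound = begin
    ((2 ℕ.+ N) ℕ.^ 2) ℕ.^ N               ≤⟨ ℕ.^-monoˡ-≤ N (ℕ.^-monoˡ-≤ 2 (ℕ.≤-trans 2+N≤ℓ (ℕ.<⇒≤ (n<2^[1+⌊log₂n⌋] ℓ)))) ⟩
    ((2 ℕ.^ suc ƛ) ℕ.^ 2) ℕ.^ N           ≡⟨ ℕ.^-*-assoc (2 ℕ.^ suc ƛ) 2 N ⟩
    (2 ℕ.^ suc ƛ) ℕ.^ (2 ℕ.* N)           ≡⟨ ℕ.^-*-assoc 2 (suc ƛ) (2 ℕ.* N) ⟩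
    2 ℕ.^ (suc ƛ ℕ.* (2 ℕ.* N))           ≤⟨ ℕ.^-monoʳ-≤ 2 (begin
      suc ƛ ℕ.* (2 ℕ.* N)       ≤⟨ ℕ.*-monoˡ-≤ (2 ℕ.* N) (ℕ.+-monoˡ-≤ ƛ 1≤ƛ) ⟩
      (ƛ ℕ.+ ƛ) ℕ.* (2 ℕ.* N)   ≡⟨ collect ƛ N ⟩
      N ℕ.* (4 ℕ.* ƛ)           ≤⟨ N4ƛ≤ℓ ⟩
      ℓ                         ∎) ⟩
    2 ℕ.^ ℓ                               ∎
    where
    collect : ∀ x N → (x ℕ.+ x) ℕ.* (2 ℕ.* N) ≡ N ℕ.* (4 ℕ.* x)
    collect = solve-∀
  ℓ≤ : ℓ ℕ.≤ 8 ℕ.* (N ℕ.* ƛ)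
  ℓ≤ = begin
    ℓ                                       ≡⟨ m≡m%n+[m/n]*n ℓ (4 ℕ.* ƛ) ⟩
    ℓ ℕ.% (4 ℕ.* ƛ) ℕ.+ N ℕ.* (4 ℕ.* ƛ)     ≤⟨ ℕ.+-monoˡ-≤ _ (ℕ.<⇒≤ (m%n<n ℓ (4 ℕ.* ƛ))) ⟩
    4 ℕ.* ƛ ℕ.+ N ℕ.* (4 ℕ.* ƛ)             ≡⟨ cong (ℕ._+ N ℕ.* (4 ℕ.* ƛ)) (ℕ.*-identityˡ (4 ℕ.* ƛ)) ⟨
    1 ℕ.* (4 ℕ.* ƛ) ℕ.+ N ℕ.* (4 ℕ.* ƛ)     ≤⟨ ℕ.+-monoˡ-≤ _ (ℕ.*-monoˡ-≤ (4 ℕ.* ƛ) 1≤N) ⟩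
    N ℕ.* (4 ℕ.* ƛ) ℕ.+ N ℕ.* (4 ℕ.* ƛ)     ≡⟨ collect ƛ N ⟩
    8 ℕ.* (N ℕ.* ƛ)                         ∎
    where
    collect : ∀ x N → N ℕ.* (4 ℕ.* x) ℕ.+ N ℕ.* (4 ℕ.* x) ≡ 8 ℕ.* (N ℕ.* x)
    collect = solve-∀

-- Embedding ℕ into ℚ

-- Division normalises through a gcd, which is stuck for a variable `n`; the explicit fraction lets
-- order and product reduce to integers. The argument 0 encodes denominator 1.
toℚ-mkℚ : ∀ n → toℚ n ≡ mkℚ (ℤ.+ n) 0 (Coprimality.sym (Coprimality.1-coprimeTo n))
toℚ-mkℚ n = ℚ.fromℚᵘ-toℚᵘ _

toℚ-mono-≤ : ∀ {m n} → m ℕ.≤ n → toℚ m ≤ toℚ n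
toℚ-mono-≤ {m} {n} m≤n rewrite toℚ-mkℚ m | toℚ-mkℚ n = *≤* (ℤ.*-monoʳ-≤-nonNeg (ℤ.+ 1) (ℤ.+≤+ m≤n))

toℚ-cancel-≤ : ∀ {m n} → toℚ m ≤ toℚ n → m ℕ.≤ n
toℚ-cancel-≤ {m} {n} m≤n rewrite toℚ-mkℚ m | toℚ-mkℚ n with m≤n
... | *≤* le = ℤ.drop‿+≤+ (ℤ.*-cancelʳ-≤-pos (ℤ.+ m) (ℤ.+ n) (ℤ.+ 1) le)

toℚ-homo-* : ∀ m n → toℚ (m ℕ.* n) ≡ toℚ m * toℚ n
toℚ-homo-* m n rewrite toℚ-mkℚ m | toℚ-mkℚ n = cong (ℚ._/ 1) (ℤ.pos-* m n)

toℚ-nonNegative : ∀ n → ℚ.NonNegative (toℚ n)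
toℚ-nonNegative n rewrite toℚ-mkℚ n = _

-- The bound on the competitive ratio

ratio≥ : ∀ {N V v R} → 1 ℕ.≤ N → N ℕ.≤ V → v ℕ.≤ 1 → toℚ V ≤ R * toℚ v → toℚ N ≤ R
-- A run of value 0 would force `V ≤ 0`, against `1 ≤ N ≤ V`, so no `R` is admissible in this case.
ratio≥ {v = zero} {R} 1≤N N≤V _ V≤ = contradiction
  (ℕ.≤-trans 1≤N (ℕ.≤-trans N≤V (toℚ-cancel-≤ {n = 0} (subst (_ ≤_) (ℚ.*-zeroʳ R) V≤)))) λ ()
ratio≥ {v = suc zero} {R} 1≤N N≤V _ V≤ = ℚ.≤-trans (toℚ-mono-≤ N≤V) (subst (_ ≤_) (ℚ.*-identityʳ R) V≤)
ratio≥ {v = suc (suc _)} _ _ (s≤s ()) _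

⅛ : ℚ
⅛ = ℤ.+ 1 ℚ./ 8

-- The hard instance gives `toℚ N ≤ R`; multiplying by the iterated logarithm avoids a division, and
-- `⅛` cancels the 8 from `parameter`.
lowerBound : ∀ k .{{_ : NonZero k}} → 16 ℕ.≤ ⌊log₂ k ⌋ → ∀ A R → Competitive k A R →
  ⅛ * toℚ ⌊log₂ k ⌋ ≤ R * toℚ ⌊log₂ ⌊log₂ k ⌋ ⌋
lowerBound k 16≤ℓ A R competitive =
  let ℓ = ⌊log₂ k ⌋
      ƛ = ⌊log₂ ℓ ⌋
      N , 1≤N , bound , ℓ≤ = parameter ℓ 16≤ℓ
      I , σ , valid , alg≤1 , N≤opt = Adversary.hardInstance A k N 1≤N (ℕ.≤-trans bound (2^⌊log₂n⌋≤n k))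
  in begin
    ⅛ * toℚ ℓ                      ≤⟨ ℚ.*-monoˡ-≤-nonNeg ⅛ (toℚ-mono-≤ ℓ≤) ⟩
    ⅛ * toℚ (8 ℕ.* (N ℕ.* ƛ))      ≡⟨ cong (⅛ *_) (toℚ-homo-* 8 (N ℕ.* ƛ)) ⟩
    ⅛ * (toℚ 8 * toℚ (N ℕ.* ƛ))    ≡⟨ ℚ.*-assoc ⅛ (toℚ 8) (toℚ (N ℕ.* ƛ)) ⟨
    ⅛ * toℚ 8 * toℚ (N ℕ.* ƛ)      ≡⟨ ℚ.*-identityˡ (toℚ (N ℕ.* ƛ)) ⟩
    toℚ (N ℕ.* ƛ)                  ≡⟨ toℚ-homo-* N ƛ ⟩
    toℚ N * toℚ ƛ                  ≤⟨ ℚ.*-monoʳ-≤-nonNeg (toℚ ƛ) {{toℚ-nonNegative ƛ}}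
                                       (ratio≥ {R = R} 1≤N N≤opt alg≤1 (competitive I valid σ)) ⟩
    R * toℚ ƛ                      ∎
  where open ℚ.≤-Reasoning

theorem5 : Σ ℚ λ C → Positive C × Σ ℕ λ K →
    ∀ (k : ℕ) → K Data.Nat.≤ k →
    ∀ (A : OnlineAlgorithm) (R : ℚ) → Competitive k A R →
    C * toℚ ⌊log₂ k ⌋ ≤ R * toℚ ⌊log₂ ⌊log₂ k ⌋ ⌋
-- The threshold `2 ^ 16` makes the logarithm of `k` at least 16, as `parameter` requires.
theorem5 = ⅛ , _ , 2 ℕ.^ 16 , λ k K≤k →
  lowerBound k {{≥2^e⇒nonZero 16 K≤k}} (e≤⌊log₂n⌋ 16 K≤k)
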